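{- Let $\lambda$ be a nonzero real number. For all integers $m,n\ge0$, \[ \phi_{n+m,\lambda}(x)=\sum_{j=0}^{m}\sum_{k=0}^{n}{m\brace j}_\lambda\binom{n}{k}(j-m\lambda)_{n-k,\lambda}\,x^{j}\,\phi_{k,\lambda}(x) \] as polynomials in $x$; equivalently, the same identity holds with $x$ replaced by the boson creation operator $a^{+}$.
   Context: $(x)_{0,\lambda}=1$ and $(x)_{n,\lambda}=x(x-\lambda)\cdots(x-(n-1)\lambda)$ for $n\ge1$. The degenerate Stirling numbers of the second kind ${n\brace k}_\lambda$ are defined by $(x)_{n,\lambda}=\sum_{k=0}^{n}{n\brace k}_\lambda (x)_k$, with $(x)_k=x(x-1)\cdots(x-k+1)$. The degenerate Bell polynomials are $\phi_{n,\lambda}(x)=\sum_{k=0}^{n}{n\brace k}_\lambda x^{k}$ (equivalently $\sum_{n\ge0}\phi_{n,\lambda}(x)t^n/n!=e^{x((1+\lambda t)^{1/\lambda}-1)}$). -}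

module Defs where

open import Algebra.Bundles using (CommutativeRing; RawRing; Ring)
open import Algebra.Definitions.RawSemiring using (_×_; _^_; sum)
open import Algebra.Morphism.Structures using (module RingMorphisms)
open import Data.Fin.Base using (toℕ)
open import Data.List.Base using (List; []; _∷_; map)
open import Data.Nat.Base using (ℕ; zero; suc; _∸_)
import Data.Nat.Base as ℕ
open import Data.Nat.Combinatorics using (_C_)
open import Level using (Level; _⊔_) renaming (suc to lsuc)

private
  variable
    a b c ℓ ℓ₁ : Level

module _ (A : RawRing a ℓ) where
  open RawRing A

  -- Both bounds are included: f 0 + ⋯ + f n.
  ∑≤ : ℕ → (ℕ → Carrier) → Carrier
  ∑≤ n f = sum rawSemiring {n = suc n} (λ i → f (toℕ i))

  fromℕ : ℕ → Carrier
  fromℕ n = _×_ rawSemiring n 1#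

  -- (x)ₙ,μ = x (x − μ) ⋯ (x − (n − 1) μ)
  degenerateFalling : Carrier → Carrier → ℕ → Carrier
  degenerateFalling μ x zero    = 1#
  degenerateFalling μ x (suc n) =
    degenerateFalling μ x n * (x + - (fromℕ n * μ))

  -- (x)ₙ = x (x − 1) ⋯ (x − (n − 1))
  falling : Carrier → ℕ → Carrier
  falling = degenerateFalling 1#

-- R[X]: a list holds the coefficients of X⁰, X¹, …; trailing zeros are
-- allowed, and equality compares all coefficients.
module Polynomial (R : CommutativeRing c ℓ) where
  open CommutativeRing R

  Poly : Set c
  Poly = List Carrier

  coeff : Poly → ℕ → Carrier
  coeff []      _       = 0#
  coeff (r ∷ p) zero    = r
  coeff (r ∷ p) (suc i) = coeff p i

  infix 4 _≈ₚ_
  _≈ₚ_ : Poly → Poly → Set ℓ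
  p ≈ₚ q = ∀ i → coeff p i ≈ coeff q i

  infixl 6 _+ₚ_
  _+ₚ_ : Poly → Poly → Poly
  []      +ₚ q       = q
  (r ∷ p) +ₚ []      = r ∷ p
  (r ∷ p) +ₚ (s ∷ q) = (r + s) ∷ (p +ₚ q)

  infixl 7 _*ₚ_
  _*ₚ_ : Poly → Poly → Poly
  []      *ₚ q = []
  (r ∷ p) *ₚ q = map (r *_) q +ₚ (0# ∷ (p *ₚ q))

  constant : Carrier → Poly
  constant r = r ∷ []

  X : Poly
  X = 0# ∷ 1# ∷ []

  polyRing : RawRing c ℓ
  polyRing = record
    { Carrier = Poly
    ; _≈_     = _≈ₚ_
    ; _+_     = _+ₚ_
    ; _*_     = _*ₚ_
    ; -_      = map (-_)
    ; 0#      = []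
    ; 1#      = constant 1#
    }

-- Associative unital R-algebras, not necessarily commutative; the scalar
-- action is r · x = ι r * x.
record AssociativeAlgebra (R : CommutativeRing c ℓ) (a ℓ₁ : Level)
       : Set (c ⊔ ℓ ⊔ lsuc (a ⊔ ℓ₁)) where
  private module R = CommutativeRing R
  field
    ring : Ring a ℓ₁
  open Ring ring public
  open RingMorphisms R.rawRing rawRing using (IsRingHomomorphism)
  field
    ι                  : R.Carrier → Carrier
    isRingHomomorphism : IsRingHomomorphism ι
    central            : ∀ r x → ι r * x ≈ x * ι r

module _ (R : CommutativeRing c ℓ) where
  private module R = CommutativeRing R
  open Polynomial R

  -- S is a family of degenerate Stirling numbers of the second kind:
  -- (X)ₙ,μ = ∑_{k ≤ n} S n k (X)ₖ in R[X].  This determines S n k for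
  -- k ≤ n, because the (X)ₖ are monic of degree k; the values S n k with
  -- k > n are unconstrained and are never used.
  IsDegenerateStirling₂ : R.Carrier → (ℕ → ℕ → R.Carrier) → Set ℓ
  IsDegenerateStirling₂ μ S = ∀ n →
    degenerateFalling polyRing (constant μ) X n
      ≈ₚ ∑≤ polyRing n (λ k → constant (S n k) *ₚ falling polyRing X k)

  module _ (S : ℕ → ℕ → R.Carrier)
           (A : RawRing a ℓ₁) (ι : R.Carrier → RawRing.Carrier A) where
    open RawRing A

    -- The degenerate Bell polynomial φₙ evaluated at x ∈ A, with ι embedding
    -- the scalars.  A = R[X], ι = constant, x = X gives the polynomial itself.
    degenerateBell : ℕ → Carrier → Carrier
    degenerateBell n x = ∑≤ A n (λ k → ι (S n k) * _^_ rawSemiring x k)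

    -- φₙ₊ₘ(x) = ∑_{j ≤ m} ∑_{k ≤ n} S m j (n C k) (j − mμ)ₙ₋ₖ,μ xʲ φₖ(x); the
    -- scalars are multiplied in R, and xʲ stands to the left of φₖ(x).
    SpiveyIdentity : R.Carrier → ℕ → ℕ → Carrier → Set ℓ₁
    SpiveyIdentity μ m n x =
      degenerateBell (n ℕ.+ m) x
        ≈ ∑≤ A m (λ j → ∑≤ A n (λ k →
            ι (S m j R.* fromℕ R.rawRing (n C k)
                R.* degenerateFalling R.rawRing μ
                      (fromℕ R.rawRing j R.- fromℕ R.rawRing m R.* μ) (n ∸ k))
              * _^_ rawSemiring x j * degenerateBell k x))

{-# OPTIONS --safe #-}
-- Let Φ be the R-linear endomorphism of R[X] with Φ((X)ₖ) = Xᵏ.  It turns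
-- multiplication by X into T = X(1 + d/dX), and φₙ = Φ((X)ₙ,μ).  Split
-- (X)ₙ₊ₘ,μ = (X)ₘ,μ (X − mμ)ₙ,μ and expand the first factor as ∑ⱼ S(m,j) (X)ⱼ.
-- Since T Xʲ = Xʲ (T + j), one has Φ((X)ⱼ f(X)) = Xʲ Φ(f(X + j)), and the
-- Vandermonde expansion of (X + j − mμ)ₙ,μ finishes the proof in R[X].
-- Evaluation at a⁺ carries the identity to any associative algebra.
module Submission where

open import Algebra.Bundles using (AbelianGroup; CommutativeRing; RawRing; Ring)
open import Algebra.Definitions.RawSemiring using (_^_; sum)
open import Algebra.Morphism.Structures
  using (module MonoidMorphisms; module RingMorphisms)
import Algebra.Properties.AbelianGroup as AbelianGroupProperties
import Algebra.Properties.CommutativeSemigroup as CommutativeSemigroupProperties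
import Algebra.Properties.Monoid.Mult as MonoidMult
import Algebra.Properties.Monoid.Sum as MonoidSum
import Algebra.Properties.Ring as RingProperties
import Algebra.Properties.Semiring.Sum as SemiringSum
import Algebra.Solver.Ring.NaturalCoefficients.Default as SemiringSolver
open import Data.Fin.Base as Fin using (Fin; toℕ)
open import Data.Fin.Properties using (toℕ≤pred[n])
open import Data.List.Base using ([]; _∷_; map)
open import Data.Nat.Base using (ℕ; zero; suc; _∸_; _≤_)
import Data.Nat.Base as ℕ
open import Data.Nat.Combinatorics
  using (_C_; nCk+nC[k+1]≡[n+1]C[k+1]; k>n⇒nCk≡0)
import Data.Nat.Properties as ℕ
open import Data.Product.Base using (_×_; _,_)
open import Level using (Level)
import Relation.Binary.PropositionalEquality as ≡
import Relation.Binary.Reasoning.Setoid as SetoidReasoning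
open import Relation.Nullary.Negation.Core using (¬_)
open import Defs

-- The obstacle is to have Φ at all. Prescribing Φ((X)ₖ) = Xᵏ would require showing beforehand that
-- the falling factorials form a basis of R[X]. Instead Φ is given on monomials by Φ(p) = p(T) 1, so
-- that Xⁱ goes to Tⁱ 1. Multiplication by X then becomes T almost by construction, and Φ((X)ₖ) = Xᵏ
-- is a consequence of T X = X (T + 1) and T 1 = X. The operator T is the Euler operator X d/dX
-- conjugated by e^X, which explains its shape: formally, Φ(p) is Dobinski's series e^(-X) ∑ p(k) Xᵏ
-- / k!. The form p(T) 1 involves no division and no series, so it makes sense over every
-- commutative ring. Horner's rule produces p(T) 1, and with left multiplication by a⁺ in place of T
-- it produces evaluation at a⁺, so both maps come from one construction. Polynomials are lists up
-- to trailing zeros, hence every map defined by recursion on lists has to be shown to respect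
-- coefficientwise equality.

private
  variable
    a b c ℓ ℓ₁ ℓ₂ : Level

-- Opaque finite sums and the identity stated with them

opaque
  -- Unlike ∑≤, this does not unfold, so that summands can be inferred.
  ∑ : (A : RawRing a ℓ) → let open RawRing A in ℕ → (ℕ → Carrier) → Carrier
  ∑ = ∑≤

module _ (R : CommutativeRing c ℓ) (S : ℕ → ℕ → CommutativeRing.Carrier R)
         (A : RawRing a ℓ₁) (ι : CommutativeRing.Carrier R → RawRing.Carrier A)
         where
  private module R = CommutativeRing R
  open RawRing A

  bell : ℕ → Carrier → Carrier
  bell n x = ∑ A n (λ k → ι (S n k) * _^_ rawSemiring x k)

  Spivey : R.Carrier → ℕ → ℕ → Carrier → Set ℓ₁
  Spivey μ m n x =
    bell (n ℕ.+ m) x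
      ≈ ∑ A m (λ j → ∑ A n (λ k →
          ι (S m j R.* fromℕ R.rawRing (n C k)
              R.* degenerateFalling R.rawRing μ
                    (fromℕ R.rawRing j R.- fromℕ R.rawRing m R.* μ) (n ∸ k))
            * _^_ rawSemiring x j * bell k x))

  opaque
    unfolding ∑

    -- Both forms coincide once `∑` unfolds. The argument leaves the opaque form here and enters it
    -- in `IsDegenerateStirling₂⇒∑`.
    Spivey⇒SpiveyIdentity : ∀ {μ} m n {x} →
      Spivey μ m n x → SpiveyIdentity R S A ι μ m n x
    Spivey⇒SpiveyIdentity m n identity = identity

opaque
  unfolding ∑

  IsDegenerateStirling₂⇒∑ : (R : CommutativeRing c ℓ) →
    let open Polynomial R in
    ∀ {μ S} → IsDegenerateStirling₂ R μ S → ∀ n →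
    degenerateFalling polyRing (constant μ) X n
      ≈ₚ ∑ polyRing n (λ k → constant (S n k) *ₚ falling polyRing X k)
  IsDegenerateStirling₂⇒∑ R isStirling = isStirling

-- Sums and binomial sums in a ring

module RingSums (A : Ring a ℓ) where
  open Ring A
  open SetoidReasoning setoid
  open MonoidMult +-monoid using (×-homo-+; ×-congˡ)

  opaque
    unfolding ∑

    ∑-zero : ∀ f → ∑ rawRing 0 f ≈ f 0
    ∑-zero f = +-identityʳ _

    ∑-head : ∀ n f →
      ∑ rawRing (suc n) f ≈ f 0 + ∑ rawRing n (λ k → f (suc k))
    ∑-head n f = refl

    ∑-cong : ∀ n {f g} → (∀ k → k ≤ n → f k ≈ g k) →
             ∑ rawRing n f ≈ ∑ rawRing n g
    ∑-cong n f≈g =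
      MonoidSum.sum-cong-≋ +-monoid {suc n} λ i → f≈g (toℕ i) (toℕ≤pred[n] i)

    ∑-+ : ∀ n f g → ∑ rawRing n (λ k → f k + g k) ≈
                   ∑ rawRing n f + ∑ rawRing n g
    ∑-+ n f g = SemiringSum.∑-distrib-+ semiring {suc n} (λ i → f (toℕ i)) (λ i → g (toℕ i))

    *-distribˡ-∑ : ∀ x n f → x * ∑ rawRing n f ≈ ∑ rawRing n (λ k → x * f k)
    *-distribˡ-∑ x n f = SemiringSum.*-distribˡ-sum semiring {suc n} x (λ i → f (toℕ i))

    *-distribʳ-∑ : ∀ x n f → ∑ rawRing n f * x ≈ ∑ rawRing n (λ k → f k * x)
    *-distribʳ-∑ x n f = SemiringSum.*-distribʳ-sum semiring {suc n} x (λ i → f (toℕ i))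

    ∑-suc : ∀ n f → ∑ rawRing (suc n) f ≈ ∑ rawRing n f + f (suc n)
    ∑-suc zero    f = begin
      f 0 + (f 1 + 0#)   ≈⟨ +-congˡ (+-identityʳ _) ⟩
      f 0 + f 1          ≈⟨ +-congʳ (+-identityʳ _) ⟨
      f 0 + 0# + f 1     ∎
    ∑-suc (suc n) f =
      trans (+-congˡ (∑-suc n (λ k → f (suc k)))) (sym (+-assoc _ _ _))

  fromℕ-+ : ∀ m n → fromℕ rawRing (m ℕ.+ n) ≈ fromℕ rawRing m + fromℕ rawRing n
  fromℕ-+ = ×-homo-+ 1#

  -- Pascal's rule in summed form: every coefficient after the first splits in two, and regrouping
  -- pairs `h k` with `h (suc k)`. With `h` arbitrary, this is the combinatorial half of the
  -- Vandermonde induction.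
  ∑-C-suc : ∀ n (h : ℕ → Carrier) →
    ∑ rawRing (suc n) (λ k → fromℕ rawRing (suc n C k) * h k) ≈
    ∑ rawRing n (λ k → fromℕ rawRing (n C k) * (h k + h (suc k)))
  ∑-C-suc n h = begin
    ∑ rawRing (suc n) (λ k → # (suc n C k) * h k)
      ≈⟨ ∑-head n _ ⟩
    t₀ + ∑ rawRing n (λ k → # (suc n C suc k) * h (suc k))
      ≈⟨ +-congˡ (∑-cong n λ k _ → pascal k) ⟩
    t₀ + ∑ rawRing n (λ k → # (n C k) * h (suc k) + # (n C suc k) * h (suc k))
      ≈⟨ +-congˡ (∑-+ n _ _) ⟩
    t₀ + (U + ∑ rawRing n (λ k → # (n C suc k) * h (suc k)))
      ≈⟨ +-congˡ (+-comm _ _) ⟩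
    t₀ + (∑ rawRing n (λ k → # (n C suc k) * h (suc k)) + U)
      ≈⟨ +-assoc _ _ _ ⟨
    t₀ + ∑ rawRing n (λ k → # (n C suc k) * h (suc k)) + U
      -- `suc n C 0` and `n C 0` both compute to `1`, so `t₀` is also the head term of row `n`.
      ≈⟨ +-congʳ (∑-head n _) ⟨
    ∑ rawRing (suc n) (λ k → # (n C k) * h k) + U
      ≈⟨ +-congʳ (∑-suc n _) ⟩
    V + # (n C suc n) * h (suc n) + U
      -- Row `n` now runs one place too far; its extra coefficient `n C suc n` vanishes.
      ≈⟨ +-congʳ (+-congˡ top) ⟩
    V + 0# + U
      ≈⟨ +-congʳ (+-identityʳ V) ⟩
    V + U
      ≈⟨ ∑-+ n _ _ ⟨
    ∑ rawRing n (λ k → # (n C k) * h k + # (n C k) * h (suc k))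
      ≈⟨ ∑-cong n (λ k _ → distribˡ _ _ _) ⟨
    ∑ rawRing n (λ k → # (n C k) * (h k + h (suc k))) ∎
    where
    # = fromℕ rawRing
    t₀ = # 1 * h 0
    U = ∑ rawRing n (λ k → # (n C k) * h (suc k))
    V = ∑ rawRing n (λ k → # (n C k) * h k)
    pascal : ∀ k → # (suc n C suc k) * h (suc k) ≈
                   # (n C k) * h (suc k) + # (n C suc k) * h (suc k)
    pascal k = trans
      (*-congʳ (trans (×-congˡ (≡.sym (nCk+nC[k+1]≡[n+1]C[k+1] n k)))
                      (fromℕ-+ (n C k) (n C suc k))))
      (distribʳ _ _ _)
    top : # (n C suc n) * h (suc n) ≈ 0#
    top = trans (*-congʳ (×-congˡ (k>n⇒nCk≡0 (ℕ.n<1+n n)))) (zeroˡ _)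

  degenerateFalling-cong : ∀ {μ ν x y} → μ ≈ ν → x ≈ y → ∀ n →
    degenerateFalling rawRing μ x n ≈ degenerateFalling rawRing ν y n
  degenerateFalling-cong μ≈ν x≈y zero    = refl
  degenerateFalling-cong μ≈ν x≈y (suc n) =
    *-cong (degenerateFalling-cong μ≈ν x≈y n)
           (+-cong x≈y (-‿cong (*-congˡ μ≈ν)))

-- Splitting and Vandermonde expansion of degenerate falling factorials

module DegenerateFalling (A : CommutativeRing a ℓ) where
  open CommutativeRing A
  open RingSums ring
  open RingProperties ring using (-‿distribʳ-*)
  open SetoidReasoning setoid
  open SemiringSolver commutativeSemiring using (solve; _:+_; _:*_; _:=_)

  private
    # = fromℕ rawRing
    F = degenerateFalling rawRing

    -- The index equation is a parameter because the two uses decompose differently: one commutes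
    -- `n + m`, the other writes `n` as `(n ∸ k) + k`.
    split-offset : ∀ m n {k} μ → k ≡.≡ m ℕ.+ n →
                   - (# k * μ) ≈ - (# m * μ) + - (# n * μ)
    split-offset m n μ ≡.refl = begin
      - (# (m ℕ.+ n) * μ)         ≈⟨ -‿distribʳ-* _ _ ⟩
      # (m ℕ.+ n) * - μ           ≈⟨ *-congʳ (fromℕ-+ m n) ⟩
      (# m + # n) * - μ           ≈⟨ distribʳ _ _ _ ⟩
      # m * - μ + # n * - μ       ≈⟨ +-cong (-‿distribʳ-* _ _) (-‿distribʳ-* _ _) ⟨
      - (# m * μ) + - (# n * μ)   ∎

  -- The last `n` factors of the long product are those of the product started at `x - mμ`; the
  -- induction on `n` compares final factors.
  degenerateFalling-+ : ∀ μ x m n →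
    F μ x (n ℕ.+ m) ≈ F μ x m * F μ (x + - (# m * μ)) n
  degenerateFalling-+ μ x m zero    = sym (*-identityʳ _)
  degenerateFalling-+ μ x m (suc n) = begin
    F μ x (n ℕ.+ m) * (x + - (# (n ℕ.+ m) * μ))
      ≈⟨ *-cong (degenerateFalling-+ μ x m n)
                (trans (+-congˡ (split-offset m n μ (ℕ.+-comm n m)))
                       (sym (+-assoc _ _ _))) ⟩
    F μ x m * F μ (x + - (# m * μ)) n * (x + - (# m * μ) + - (# n * μ))
      ≈⟨ *-assoc _ _ _ ⟩
    F μ x m * F μ (x + - (# m * μ)) (suc n) ∎

  -- The new factor is `x + y - nμ = (y - (n - k)μ) + (x - kμ)`. In the `k`-th summand its first
  -- part lengthens the product in `y` and its second part the product in `x`, which gives the pairs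
  -- that `∑-C-suc` collects.
  degenerateVandermonde : ∀ μ x y n →
    F μ (x + y) n ≈ ∑ rawRing n (λ k → # (n C k) * (F μ y (n ∸ k) * F μ x k))
  degenerateVandermonde μ x y zero    =
    sym (trans (∑-zero _) (trans (*-cong (+-identityʳ 1#) (*-identityʳ 1#)) (*-identityʳ 1#)))
  degenerateVandermonde μ x y (suc n) = begin
    F μ (x + y) n * (x + y + - (# n * μ))
      ≈⟨ *-congʳ (degenerateVandermonde μ x y n) ⟩
    ∑ rawRing n (λ k → # (n C k) * (F μ y (n ∸ k) * F μ x k)) * (x + y + - (# n * μ))
      ≈⟨ *-distribʳ-∑ _ n _ ⟩
    ∑ rawRing n (λ k → # (n C k) * (F μ y (n ∸ k) * F μ x k) * (x + y + - (# n * μ)))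
      ≈⟨ ∑-cong n step ⟩
    ∑ rawRing n (λ k → # (n C k) * (h k + h (suc k)))
      ≈⟨ ∑-C-suc n h ⟨
    ∑ rawRing (suc n) (λ k → # (suc n C k) * h k) ∎
    where
    h : ℕ → Carrier
    h k = F μ y (suc n ∸ k) * F μ x k
    step : ∀ k → k ≤ n →
      # (n C k) * (F μ y (n ∸ k) * F μ x k) * (x + y + - (# n * μ)) ≈
      # (n C k) * (h k + h (suc k))
    step k k≤n = begin
      # (n C k) * (F μ y (n ∸ k) * F μ x k) * (x + y + - (# n * μ))
        ≈⟨ *-congˡ (+-congˡ (split-offset (n ∸ k) k μ (≡.sym (ℕ.m∸n+n≡m k≤n)))) ⟩
      # (n C k) * (F μ y (n ∸ k) * F μ x k) *
        (x + y + (- (# (n ∸ k) * μ) + - (# k * μ)))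
        ≈⟨ solve 7 (λ b f g x y u v →
             b :* (f :* g) :* (x :+ y :+ (u :+ v)) :=
             b :* (f :* (y :+ u) :* g :+ f :* (g :* (x :+ v))))
             refl _ _ _ _ _ _ _ ⟩
      # (n C k) * (F μ y (suc (n ∸ k)) * F μ x k + h (suc k))
        -- `h` is written with `suc n ∸ k`, which equals `suc (n ∸ k)` because `k ≤ n`.
        ≈⟨ *-congˡ (+-congʳ (*-congʳ (reflexive
             (≡.cong (F μ y) (≡.sym (ℕ.+-∸-assoc 1 k≤n)))))) ⟩
      # (n C k) * (h k + h (suc k)) ∎

-- Transport along homomorphisms

opaque
  unfolding ∑

  -- Assumes additivity alone, so that it covers ring homomorphisms as well as Φ, which is not
  -- multiplicative.
  ∑-homo : (A : RawRing a ℓ) (B : Ring b ℓ₂) →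
    let module A = RawRing A
        module B = Ring B in
    (f : A.Carrier → B.Carrier) → f A.0# B.≈ B.0# →
    (∀ x y → f (x A.+ y) B.≈ f x B.+ f y) →
    ∀ n g → f (∑ A n g) B.≈ ∑ B.rawRing n (λ k → f (g k))
  ∑-homo A B f 0-homo +-homo n g = go (suc n) (λ i → g (toℕ i))
    where
    module A = RawRing A
    module B = Ring B
    go : ∀ n (t : Fin n → A.Carrier) →
         f (sum A.rawSemiring t) B.≈ sum (RawRing.rawSemiring B.rawRing) (λ i → f (t i))
    go zero    t = 0-homo
    go (suc n) t =
      B.trans (+-homo _ _) (B.+-congˡ (go n (λ i → t (Fin.suc i))))

module Homomorphism (A : RawRing a ℓ) (B : Ring b ℓ₂) where
  private
    module A = RawRing A
    module B = Ring B
  open RingMorphisms A B.rawRing using (IsRingHomomorphism)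

  module _ {f : A.Carrier → B.Carrier} (isHom : IsRingHomomorphism f) where
    open IsRingHomomorphism isHom

    fromℕ-homo : ∀ n → f (fromℕ A n) B.≈ fromℕ B.rawRing n
    fromℕ-homo zero    = 0#-homo
    fromℕ-homo (suc n) =
      B.trans (+-homo _ _) (B.+-cong 1#-homo (fromℕ-homo n))

    ^-homo : ∀ x n →
             f (_^_ A.rawSemiring x n) B.≈ _^_ (RawRing.rawSemiring B.rawRing) (f x) n
    ^-homo x zero    = 1#-homo
    ^-homo x (suc n) = B.trans (*-homo _ _) (B.*-congˡ (^-homo x n))

    degenerateFalling-homo : ∀ μ x n →
      f (degenerateFalling A μ x n) B.≈ degenerateFalling B.rawRing (f μ) (f x) n
    degenerateFalling-homo μ x zero    = 1#-homo
    degenerateFalling-homo μ x (suc n) = B.trans (*-homo _ _)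
      (B.*-cong (degenerateFalling-homo μ x n)
        (B.trans (+-homo _ _) (B.+-congˡ
          (B.trans (-‿homo _) (B.-‿cong
            (B.trans (*-homo _ _) (B.*-congʳ (fromℕ-homo n))))))))

    module _ (R : CommutativeRing c ℓ₁) where
      private module R = CommutativeRing R

      module _ {ι : R.Carrier → A.Carrier} {κ : R.Carrier → B.Carrier}
               (f∘ι≈κ : ∀ r → f (ι r) B.≈ κ r) (S : ℕ → ℕ → R.Carrier)
               {x : A.Carrier} {y : B.Carrier} (fx≈y : f x B.≈ y) where
        private
          ^-homo′ : ∀ n → f (_^_ A.rawSemiring x n) B.≈ _^_ (RawRing.rawSemiring B.rawRing) y n
          ^-homo′ n = B.trans (^-homo x n)
            (MonoidMult.×-congʳ B.*-monoid n fx≈y)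

        bell-homo : ∀ n →
          f (bell R S A ι n x) B.≈ bell R S B.rawRing κ n y
        bell-homo n = B.trans
          (∑-homo A B f 0#-homo +-homo n _)
          (RingSums.∑-cong B n λ k _ →
            B.trans (*-homo _ _) (B.*-cong (f∘ι≈κ _) (^-homo′ k)))

        -- The coefficients are computed in `R` before `ι` is applied, so it is enough to know `f`
        -- on scalars and at `x`.
        Spivey-homo : ∀ μ m n →
          Spivey R S A ι μ m n x → Spivey R S B.rawRing κ μ m n y
        Spivey-homo μ m n identity =
          B.trans (B.sym (bell-homo (n ℕ.+ m)))
          (B.trans (⟦⟧-cong identity)
          (B.trans (∑-homo A B f 0#-homo +-homo m _)
          (RingSums.∑-cong B m λ j _ →
          B.trans (∑-homo A B f 0#-homo +-homo n _)
          (RingSums.∑-cong B n λ k _ →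
          B.trans (*-homo _ _) (B.*-cong
            (B.trans (*-homo _ _) (B.*-cong (f∘ι≈κ _) (^-homo′ j)))
            (bell-homo k))))))

-- The umbral argument, with ι : R → P in the role of R → R[X].
module Umbral (R : CommutativeRing c ℓ) (P : CommutativeRing a ℓ₁) where
  private module R = CommutativeRing R
  open CommutativeRing P
  open RingMorphisms R.rawRing rawRing using (IsRingHomomorphism)
  open MonoidMorphisms +-rawMonoid +-rawMonoid using (IsMonoidHomomorphism)

  -- The relation `T-x` says T x = x (T + 1) as operators. Together with the initial values `T-1`
  -- and `Φ-1` and the intertwining `Φ-x`, it is all that the argument knows of the derivative
  -- behind `T`.
  module _
    {ι : R.Carrier → Carrier} (isHom : IsRingHomomorphism ι) (x : Carrier)
    {Φ : Carrier → Carrier} (T : Carrier → Carrier)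
    (Φ-isHom : IsMonoidHomomorphism Φ)
    (Φ-ι : ∀ r p → Φ (ι r * p) ≈ ι r * Φ p)
    (Φ-1 : Φ 1# ≈ 1#)
    (Φ-x : ∀ p → Φ (x * p) ≈ T (Φ p))
    (T-cong : ∀ {p q} → p ≈ q → T p ≈ T q)
    (T-1 : T 1# ≈ x)
    (T-x : ∀ p → T (x * p) ≈ x * (T p + p))
    where

    private module Φ = IsMonoidHomomorphism Φ-isHom
    open IsRingHomomorphism isHom
    open Homomorphism R.rawRing ring
    open RingSums ring
    open DegenerateFalling P
    open SetoidReasoning setoid
    open SemiringSolver commutativeSemiring using (solve; con; _:+_; _:*_; _:=_)

    private
      # = fromℕ rawRing
      #R = fromℕ R.rawRing
      F = degenerateFalling rawRing
      infixr 8 _^^_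
      _^^_ = _^_ (RawRing.rawSemiring rawRing)

    -- Lets falling factorials be processed one factor at a time. The factor is a separate `d`
    -- because the products contain `x + - (# n * ι μ)`, which only equals some `x + ι r`.
    Φ-linearFactor : ∀ p r {d} → d ≈ x + ι r → Φ (p * d) ≈ T (Φ p) + ι r * Φ p
    Φ-linearFactor p r {d} d≈x+ιr = begin
      Φ (p * d)               ≈⟨ Φ.⟦⟧-cong (*-congˡ d≈x+ιr) ⟩
      Φ (p * (x + ι r))       ≈⟨ Φ.⟦⟧-cong (trans (*-comm _ _) (distribʳ _ _ _)) ⟩
      Φ (x * p + ι r * p)     ≈⟨ Φ.homo _ _ ⟩
      Φ (x * p) + Φ (ι r * p) ≈⟨ +-cong (Φ-x p) (Φ-ι r p) ⟩
      T (Φ p) + ι r * Φ p     ∎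

    T-x^ : ∀ j p → T (x ^^ j * p) ≈ x ^^ j * (T p + # j * p)
    T-x^ zero    p = trans (T-cong (*-identityˡ p))
      (solve 2 (λ t p → t := con 1 :* (t :+ con 0 :* p)) refl _ _)
    T-x^ (suc j) p = begin
      T (x * x ^^ j * p)
        ≈⟨ T-cong (*-assoc _ _ _) ⟩
      T (x * (x ^^ j * p))
        ≈⟨ T-x _ ⟩
      x * (T (x ^^ j * p) + x ^^ j * p)
        ≈⟨ *-congˡ (+-congʳ (T-x^ j p)) ⟩
      x * (x ^^ j * (T p + # j * p) + x ^^ j * p)
        ≈⟨ solve 5 (λ x y t n p →
             x :* (y :* (t :+ n :* p) :+ y :* p) :=
             x :* y :* (t :+ (con 1 :+ n) :* p)) refl _ _ _ _ _ ⟩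
      x * x ^^ j * (T p + (1# + # j) * p) ∎

    -- The factor `x - j` acts as T - j, and its -j cancels the `j` gained when T moves past
    -- `x ^^ j`. What is left is `x ^^ j` times `T 1#`, which is `x`.
    Φ-falling : ∀ j → Φ (falling rawRing x j) ≈ x ^^ j
    Φ-falling zero    = Φ-1
    Φ-falling (suc j) = begin
      Φ (falling rawRing x j * (x + - (# j * 1#)))
        ≈⟨ Φ-linearFactor _ (R.- #R j) (+-congˡ offset) ⟩
      T (Φ (falling rawRing x j)) + ι (R.- #R j) * Φ (falling rawRing x j)
        ≈⟨ +-cong (T-cong (trans (Φ-falling j) (sym (*-identityʳ _))))
                  (*-cong (trans (-‿homo _) (-‿cong (fromℕ-homo isHom j))) (Φ-falling j)) ⟩
      T (x ^^ j * 1#) + - # j * x ^^ j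
        ≈⟨ +-congʳ (T-x^ j 1#) ⟩
      x ^^ j * (T 1# + # j * 1#) + - # j * x ^^ j
        ≈⟨ solve 4 (λ y t n m →
             y :* (t :+ n :* con 1) :+ m :* y := t :* y :+ y :* (n :+ m))
             refl _ _ _ _ ⟩
      T 1# * x ^^ j + x ^^ j * (# j + - # j)
        ≈⟨ +-cong (*-congʳ T-1) (trans (*-congˡ (-‿inverseʳ _)) (zeroʳ _)) ⟩
      x * x ^^ j + 0#
        ≈⟨ +-identityʳ _ ⟩
      x * x ^^ j ∎
      where
      offset : - (# j * 1#) ≈ ι (R.- #R j)
      offset = sym (trans (-‿homo _)
        (-‿cong (trans (fromℕ-homo isHom j) (sym (*-identityʳ _)))))

    module _ (μ : R.Carrier) where

      private
        ι-offset : ∀ n → ι (R.- (#R n R.* μ)) ≈ - (# n * ι μ)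
        ι-offset n = trans (-‿homo _)
          (-‿cong (trans (*-homo _ _) (*-congʳ (fromℕ-homo isHom n))))

        ι-factor : ∀ r n → x + ι r + - (# n * ι μ) ≈ x + ι (r R.- #R n R.* μ)
        ι-factor r n = trans (+-assoc _ _ _)
          (+-congˡ (sym (trans (+-homo _ _) (+-congˡ (ι-offset n)))))

      -- The shift rule for products of linear factors only, so no substitution X ↦ X + j on
      -- polynomials has to be defined. A factor `x + s` acts as T + s, and moving it past `x ^^ j`
      -- turns it into T + j + s, the action of the matching factor of the shifted product.
      Φ-falling-* : ∀ j r n →
        Φ (falling rawRing x j * F (ι μ) (x + ι r) n) ≈
        x ^^ j * Φ (F (ι μ) (x + ι (#R j R.+ r)) n)
      Φ-falling-* j r zero    = trans (Φ.⟦⟧-cong (*-identityʳ _))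
        (trans (Φ-falling j) (sym (trans (*-congˡ Φ-1) (*-identityʳ _))))
      Φ-falling-* j r (suc n) = begin
        Φ (falling rawRing x j * (F (ι μ) (x + ι r) n * (x + ι r + - (# n * ι μ))))
          ≈⟨ Φ.⟦⟧-cong (*-assoc _ _ _) ⟨
        Φ (falling rawRing x j * F (ι μ) (x + ι r) n * (x + ι r + - (# n * ι μ)))
          ≈⟨ Φ-linearFactor _ _ (ι-factor r n) ⟩
        T (Φ (falling rawRing x j * F (ι μ) (x + ι r) n)) +
          ι s * Φ (falling rawRing x j * F (ι μ) (x + ι r) n)
          ≈⟨ +-cong (T-cong (Φ-falling-* j r n)) (*-congˡ (Φ-falling-* j r n)) ⟩
        T (x ^^ j * y) + ι s * (x ^^ j * y)
          ≈⟨ +-congʳ (T-x^ j y) ⟩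
        x ^^ j * (T y + # j * y) + ι s * (x ^^ j * y)
          ≈⟨ solve 5 (λ x t n y s →
               x :* (t :+ n :* y) :+ s :* (x :* y) := x :* (t :+ (n :+ s) :* y))
               refl _ _ _ _ _ ⟩
        x ^^ j * (T y + (# j + ι s) * y)
          ≈⟨ *-congˡ (+-congˡ (*-congʳ j+s)) ⟩
        x ^^ j * (T y + ι (#R j R.+ r R.- #R n R.* μ) * y)
          ≈⟨ *-congˡ (Φ-linearFactor _ _ (ι-factor (#R j R.+ r) n)) ⟨
        x ^^ j * Φ (F (ι μ) (x + ι (#R j R.+ r)) (suc n)) ∎
        where
        s = r R.- #R n R.* μ
        y = Φ (F (ι μ) (x + ι (#R j R.+ r)) n)
        j+s : # j + ι s ≈ ι (#R j R.+ r R.- #R n R.* μ)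
        j+s = trans (+-congʳ (sym (fromℕ-homo isHom j)))
          (trans (sym (+-homo _ _)) (⟦⟧-cong (R.sym (R.+-assoc _ _ _))))

      module _ (S : ℕ → ℕ → R.Carrier)
               (isStirling : ∀ n → F (ι μ) x n ≈
                 ∑ rawRing n (λ k → ι (S n k) * falling rawRing x k)) where

        private
          φ : ℕ → Carrier
          φ n = bell R S rawRing ι n x

          Φ-∑ : ∀ n g → Φ (∑ rawRing n g) ≈ ∑ rawRing n (λ k → Φ (g k))
          Φ-∑ = ∑-homo rawRing ring Φ Φ.ε-homo Φ.homo

        Φ-degenerateFalling : ∀ n → Φ (F (ι μ) x n) ≈ φ n
        Φ-degenerateFalling n = begin
          Φ (F (ι μ) x n)
            ≈⟨ Φ.⟦⟧-cong (isStirling n) ⟩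
          Φ (∑ rawRing n (λ k → ι (S n k) * falling rawRing x k))
            ≈⟨ Φ-∑ n _ ⟩
          ∑ rawRing n (λ k → Φ (ι (S n k) * falling rawRing x k))
            ≈⟨ ∑-cong n (λ k _ → trans (Φ-ι _ _) (*-congˡ (Φ-falling k))) ⟩
          φ n ∎

        -- Vandermonde separates `ι r` from `x`. The part in `ι r` is the image of a scalar, so it
        -- leaves Φ by linearity.
        Φ-degenerateFalling-shift : ∀ r n →
          Φ (F (ι μ) (x + ι r) n) ≈
          ∑ rawRing n (λ k →
            ι (#R (n C k) R.* degenerateFalling R.rawRing μ r (n ∸ k)) * φ k)
        Φ-degenerateFalling-shift r n = begin
          Φ (F (ι μ) (x + ι r) n)
            ≈⟨ Φ.⟦⟧-cong (degenerateVandermonde (ι μ) x (ι r) n) ⟩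
          Φ (∑ rawRing n (λ k → # (n C k) * (F (ι μ) (ι r) (n ∸ k) * F (ι μ) x k)))
            ≈⟨ Φ-∑ n _ ⟩
          ∑ rawRing n (λ k → Φ (# (n C k) * (F (ι μ) (ι r) (n ∸ k) * F (ι μ) x k)))
            ≈⟨ ∑-cong n (λ k _ → trans (Φ.⟦⟧-cong (scalars k))
                 (trans (Φ-ι _ _) (*-congˡ (Φ-degenerateFalling k)))) ⟩
          ∑ rawRing n (λ k →
            ι (#R (n C k) R.* degenerateFalling R.rawRing μ r (n ∸ k)) * φ k) ∎
          where
          scalars : ∀ k →
            # (n C k) * (F (ι μ) (ι r) (n ∸ k) * F (ι μ) x k) ≈
            ι (#R (n C k) R.* degenerateFalling R.rawRing μ r (n ∸ k)) * F (ι μ) x k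
          scalars k = trans (sym (*-assoc _ _ _)) (*-congʳ (sym
            (trans (*-homo _ _) (*-cong (fromℕ-homo isHom (n C k))
                                (degenerateFalling-homo isHom μ r (n ∸ k))))))

        spivey : ∀ m n → Spivey R S rawRing ι μ m n x
        spivey m n = begin
          φ (n ℕ.+ m)
            ≈⟨ Φ-degenerateFalling (n ℕ.+ m) ⟨
          Φ (F (ι μ) x (n ℕ.+ m))
            ≈⟨ Φ.⟦⟧-cong (degenerateFalling-+ (ι μ) x m n) ⟩
          Φ (F (ι μ) x m * F (ι μ) (x + - (# m * ι μ)) n)
            -- Only the first block is expanded. The second stays a product, its offset rewritten as
            -- the image of the scalar `-mμ` to fit `Φ-falling-*`.
            ≈⟨ Φ.⟦⟧-cong (*-cong (isStirling m)
                 (degenerateFalling-cong refl (+-congˡ (sym (ι-offset m))) n)) ⟩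
          Φ (∑ rawRing m (λ j → ι (S m j) * falling rawRing x j) * Q)
            ≈⟨ Φ.⟦⟧-cong (*-distribʳ-∑ Q m _) ⟩
          Φ (∑ rawRing m (λ j → ι (S m j) * falling rawRing x j * Q))
            ≈⟨ Φ-∑ m _ ⟩
          ∑ rawRing m (λ j → Φ (ι (S m j) * falling rawRing x j * Q))
            ≈⟨ ∑-cong m (λ j _ → row j) ⟩
          ∑ rawRing m (λ j → ∑ rawRing n (λ k →
            ι (S m j R.* #R (n C k) R.* degenerateFalling R.rawRing μ (r j) (n ∸ k))
              * x ^^ j * φ k)) ∎
          where
          Q = F (ι μ) (x + ι (R.- (#R m R.* μ))) n
          r : ℕ → R.Carrier
          r j = #R j R.- #R m R.* μ
          row : ∀ j → Φ (ι (S m j) * falling rawRing x j * Q) ≈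
            ∑ rawRing n (λ k →
              ι (S m j R.* #R (n C k) R.* degenerateFalling R.rawRing μ (r j) (n ∸ k))
                * x ^^ j * φ k)
          row j = begin
            Φ (ι (S m j) * falling rawRing x j * Q)
              ≈⟨ trans (Φ.⟦⟧-cong (*-assoc _ _ _)) (Φ-ι _ _) ⟩
            ι (S m j) * Φ (falling rawRing x j * Q)
              -- The shift by `j` is added to the offset `-mμ`; this is the origin of `r j`.
              ≈⟨ *-congˡ (Φ-falling-* j _ n) ⟩
            ι (S m j) * (x ^^ j * Φ (F (ι μ) (x + ι (r j)) n))
              ≈⟨ *-assoc _ _ _ ⟨
            ι (S m j) * x ^^ j * Φ (F (ι μ) (x + ι (r j)) n)
              ≈⟨ *-congˡ (Φ-degenerateFalling-shift (r j) n) ⟩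
            ι (S m j) * x ^^ j * ∑ rawRing n (λ k →
              ι (#R (n C k) R.* degenerateFalling R.rawRing μ (r j) (n ∸ k)) * φ k)
              ≈⟨ *-distribˡ-∑ _ n _ ⟩
            ∑ rawRing n (λ k → ι (S m j) * x ^^ j *
              (ι (#R (n C k) R.* degenerateFalling R.rawRing μ (r j) (n ∸ k)) * φ k))
              ≈⟨ ∑-cong n (λ k _ → trans
                   (solve 4 (λ s y c f → s :* y :* (c :* f) := s :* c :* y :* f)
                     refl _ _ _ _)
                   (*-congʳ (*-congʳ (trans (sym (*-homo _ _))
                     (⟦⟧-cong (R.sym (R.*-assoc _ _ _))))))) ⟩
            ∑ rawRing n (λ k →
              ι (S m j R.* #R (n C k) R.* degenerateFalling R.rawRing μ (r j) (n ∸ k))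
                * x ^^ j * φ k) ∎

-- The commutative ring R[X] of coefficient lists

module PolynomialRing (R : CommutativeRing c ℓ) where
  open CommutativeRing R hiding (zero)
  open Polynomial R
  open RingProperties ring using (-0#≈0#)
  open SetoidReasoning setoid
  open SemiringSolver commutativeSemiring using (solve; con; _:+_; _:*_; _:=_)

  coeff-+ₚ : ∀ p q i → coeff (p +ₚ q) i ≈ coeff p i + coeff q i
  coeff-+ₚ []      q       i       = sym (+-identityˡ _)
  coeff-+ₚ (r ∷ p) []      i       = sym (+-identityʳ _)
  coeff-+ₚ (r ∷ p) (s ∷ q) zero    = refl
  coeff-+ₚ (r ∷ p) (s ∷ q) (suc i) = coeff-+ₚ p q i

  coeff-map : ∀ {f} → f 0# ≈ 0# → ∀ p i → coeff (map f p) i ≈ f (coeff p i)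
  coeff-map f0≈0 []      i       = sym f0≈0
  coeff-map f0≈0 (r ∷ p) zero    = refl
  coeff-map f0≈0 (r ∷ p) (suc i) = coeff-map f0≈0 p i

  coeff-scale : ∀ r p i → coeff (map (r *_) p) i ≈ r * coeff p i
  coeff-scale r = coeff-map (zeroʳ r)

  -- Polynomials act on coefficient sequences. With a sequence instead of a list on the right, the
  -- length of the second factor disappears from the proofs.
  convolve : Poly → (ℕ → Carrier) → ℕ → Carrier
  convolve []      g i       = 0#
  convolve (r ∷ p) g zero    = r * g zero
  convolve (r ∷ p) g (suc i) = r * g (suc i) + convolve p g i

  coeff-*ₚ : ∀ p q i → coeff (p *ₚ q) i ≈ convolve p (coeff q) i
  coeff-*ₚ []      q i = refl
  coeff-*ₚ (r ∷ p) q i =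
    trans (coeff-+ₚ (map (r *_) q) (0# ∷ (p *ₚ q)) i) (go i)
    where
    go : ∀ i → coeff (map (r *_) q) i + coeff (0# ∷ (p *ₚ q)) i ≈
               convolve (r ∷ p) (coeff q) i
    go zero    = trans (+-identityʳ _) (coeff-scale r q zero)
    go (suc i) = +-cong (coeff-scale r q (suc i)) (coeff-*ₚ p q i)

  convolve-cong : ∀ p {g h} → (∀ i → g i ≈ h i) →
                  ∀ i → convolve p g i ≈ convolve p h i
  convolve-cong []      g≈h i       = refl
  convolve-cong (r ∷ p) g≈h zero    = *-congˡ (g≈h zero)
  convolve-cong (r ∷ p) g≈h (suc i) =
    +-cong (*-congˡ (g≈h (suc i))) (convolve-cong p g≈h i)

  convolve-+ₚ : ∀ p q g i →
    convolve (p +ₚ q) g i ≈ convolve p g i + convolve q g i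
  convolve-+ₚ []      q       g i       = sym (+-identityˡ _)
  convolve-+ₚ (r ∷ p) []      g i       = sym (+-identityʳ _)
  convolve-+ₚ (r ∷ p) (s ∷ q) g zero    = distribʳ _ _ _
  convolve-+ₚ (r ∷ p) (s ∷ q) g (suc i) = trans
    (+-congˡ (convolve-+ₚ p q g i))
    (solve 5 (λ r s g u v →
      (r :+ s) :* g :+ (u :+ v) := (r :* g :+ u) :+ (s :* g :+ v))
      refl _ _ _ _ _)

  convolve-scale : ∀ r p g i → convolve (map (r *_) p) g i ≈ r * convolve p g i
  convolve-scale r []      g i       = sym (zeroʳ r)
  convolve-scale r (s ∷ p) g zero    = *-assoc _ _ _
  convolve-scale r (s ∷ p) g (suc i) = trans
    (+-cong (*-assoc _ _ _) (convolve-scale r p g i)) (sym (distribˡ _ _ _))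

  -- The product acts as the composite of the two actions, which is associativity in disguise.
  convolve-*ₚ : ∀ p q g i →
    convolve (p *ₚ q) g i ≈ convolve p (convolve q g) i
  convolve-*ₚ []      q g i = refl
  convolve-*ₚ (r ∷ p) q g i = trans
    (convolve-+ₚ (map (r *_) q) (0# ∷ (p *ₚ q)) g i)
    (trans (+-congʳ (convolve-scale r q g i)) (go i))
    where
    go : ∀ i → r * convolve q g i + convolve (0# ∷ (p *ₚ q)) g i ≈
               convolve (r ∷ p) (convolve q g) i
    go zero    = trans (+-congˡ (zeroˡ _)) (+-identityʳ _)
    go (suc i) = +-congˡ (trans (+-congʳ (zeroˡ _))
      (trans (+-identityˡ _) (convolve-*ₚ p q g i)))

  convolve-∷-zero : ∀ p s q → convolve p (coeff (s ∷ q)) 0 ≈ coeff p 0 * s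
  convolve-∷-zero []      s q = sym (zeroˡ s)
  convolve-∷-zero (r ∷ p) s q = refl

  -- The mirror image of the last clause of `convolve`: it peels the right factor, as commutativity
  -- requires.
  convolve-∷-suc : ∀ p s q i →
    convolve p (coeff (s ∷ q)) (suc i) ≈
    coeff p (suc i) * s + convolve p (coeff q) i
  convolve-∷-suc []      s q i       = sym (trans (+-congʳ (zeroˡ s)) (+-identityˡ 0#))
  convolve-∷-suc (r ∷ p) s q zero    =
    trans (+-congˡ (convolve-∷-zero p s q)) (+-comm _ _)
  convolve-∷-suc (r ∷ p) s q (suc i) = trans
    (+-congˡ (convolve-∷-suc p s q i))
    (solve 3 (λ u v w → u :+ (v :+ w) := v :+ (u :+ w)) refl _ _ _)

  convolve-comm : ∀ p q i → convolve p (coeff q) i ≈ convolve q (coeff p) i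
  convolve-comm []      []      i       = refl
  convolve-comm (r ∷ p) []      zero    = zeroʳ r
  convolve-comm (r ∷ p) []      (suc i) =
    trans (+-cong (zeroʳ r) (convolve-comm p [] i)) (+-identityˡ 0#)
  convolve-comm p       (s ∷ q) zero    =
    trans (convolve-∷-zero p s q) (*-comm _ _)
  convolve-comm p       (s ∷ q) (suc i) = trans (convolve-∷-suc p s q i)
    (+-cong (*-comm _ _) (convolve-comm p q i))

  +ₚ-cong : ∀ p q u v → p ≈ₚ q → u ≈ₚ v → (p +ₚ u) ≈ₚ (q +ₚ v)
  +ₚ-cong p q u v p≈q u≈v i = begin
    coeff (p +ₚ u) i       ≈⟨ coeff-+ₚ p u i ⟩
    coeff p i + coeff u i  ≈⟨ +-cong (p≈q i) (u≈v i) ⟩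
    coeff q i + coeff v i  ≈⟨ coeff-+ₚ q v i ⟨
    coeff (q +ₚ v) i       ∎

  +ₚ-assoc : ∀ p q u → (p +ₚ q +ₚ u) ≈ₚ (p +ₚ (q +ₚ u))
  +ₚ-assoc p q u i = begin
    coeff (p +ₚ q +ₚ u) i                ≈⟨ coeff-+ₚ (p +ₚ q) u i ⟩
    coeff (p +ₚ q) i + coeff u i         ≈⟨ +-congʳ (coeff-+ₚ p q i) ⟩
    coeff p i + coeff q i + coeff u i    ≈⟨ +-assoc _ _ _ ⟩
    coeff p i + (coeff q i + coeff u i)  ≈⟨ +-congˡ (coeff-+ₚ q u i) ⟨
    coeff p i + coeff (q +ₚ u) i         ≈⟨ coeff-+ₚ p (q +ₚ u) i ⟨
    coeff (p +ₚ (q +ₚ u)) i              ∎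

  +ₚ-comm : ∀ p q → (p +ₚ q) ≈ₚ (q +ₚ p)
  +ₚ-comm p q i = begin
    coeff (p +ₚ q) i       ≈⟨ coeff-+ₚ p q i ⟩
    coeff p i + coeff q i  ≈⟨ +-comm _ _ ⟩
    coeff q i + coeff p i  ≈⟨ coeff-+ₚ q p i ⟨
    coeff (q +ₚ p) i       ∎

  +ₚ-identityʳ : ∀ p → (p +ₚ []) ≈ₚ p
  +ₚ-identityʳ p i = trans (coeff-+ₚ p [] i) (+-identityʳ _)

  -ₚ-inverseˡ : ∀ p → (map (-_) p +ₚ p) ≈ₚ []
  -ₚ-inverseˡ p i = begin
    coeff (map (-_) p +ₚ p) i        ≈⟨ coeff-+ₚ (map (-_) p) p i ⟩
    coeff (map (-_) p) i + coeff p i ≈⟨ +-congʳ (coeff-map -0#≈0# p i) ⟩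
    - coeff p i + coeff p i          ≈⟨ -‿inverseˡ _ ⟩
    0#                               ∎

  -ₚ-cong : ∀ p q → p ≈ₚ q → map (-_) p ≈ₚ map (-_) q
  -ₚ-cong p q p≈q i = begin
    coeff (map (-_) p) i  ≈⟨ coeff-map -0#≈0# p i ⟩
    - coeff p i           ≈⟨ -‿cong (p≈q i) ⟩
    - coeff q i           ≈⟨ coeff-map -0#≈0# q i ⟨
    coeff (map (-_) q) i  ∎

  *ₚ-comm : ∀ p q → (p *ₚ q) ≈ₚ (q *ₚ p)
  *ₚ-comm p q i = begin
    coeff (p *ₚ q) i        ≈⟨ coeff-*ₚ p q i ⟩
    convolve p (coeff q) i  ≈⟨ convolve-comm p q i ⟩
    convolve q (coeff p) i  ≈⟨ coeff-*ₚ q p i ⟨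
    coeff (q *ₚ p) i        ∎

  *ₚ-congˡ : ∀ p u v → u ≈ₚ v → (p *ₚ u) ≈ₚ (p *ₚ v)
  *ₚ-congˡ p u v u≈v i = begin
    coeff (p *ₚ u) i        ≈⟨ coeff-*ₚ p u i ⟩
    convolve p (coeff u) i  ≈⟨ convolve-cong p u≈v i ⟩
    convolve p (coeff v) i  ≈⟨ coeff-*ₚ p v i ⟨
    coeff (p *ₚ v) i        ∎

  -- Equal left factors may be lists of different lengths, which does not suit recursion on them;
  -- commutativity moves them to the right.
  *ₚ-cong : ∀ p q u v → p ≈ₚ q → u ≈ₚ v → (p *ₚ u) ≈ₚ (q *ₚ v)
  *ₚ-cong p q u v p≈q u≈v i = begin
    coeff (p *ₚ u) i  ≈⟨ *ₚ-congˡ p u v u≈v i ⟩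
    coeff (p *ₚ v) i  ≈⟨ *ₚ-comm p v i ⟩
    coeff (v *ₚ p) i  ≈⟨ *ₚ-congˡ v p q p≈q i ⟩
    coeff (v *ₚ q) i  ≈⟨ *ₚ-comm v q i ⟩
    coeff (q *ₚ v) i  ∎

  *ₚ-assoc : ∀ p q u → (p *ₚ q *ₚ u) ≈ₚ (p *ₚ (q *ₚ u))
  *ₚ-assoc p q u i = begin
    coeff (p *ₚ q *ₚ u) i              ≈⟨ coeff-*ₚ (p *ₚ q) u i ⟩
    convolve (p *ₚ q) (coeff u) i      ≈⟨ convolve-*ₚ p q (coeff u) i ⟩
    convolve p (convolve q (coeff u)) i ≈⟨ convolve-cong p (coeff-*ₚ q u) i ⟨
    convolve p (coeff (q *ₚ u)) i      ≈⟨ coeff-*ₚ p (q *ₚ u) i ⟨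
    coeff (p *ₚ (q *ₚ u)) i            ∎

  *ₚ-distribʳ-+ₚ : ∀ u p q → ((p +ₚ q) *ₚ u) ≈ₚ (p *ₚ u +ₚ q *ₚ u)
  *ₚ-distribʳ-+ₚ u p q i = begin
    coeff ((p +ₚ q) *ₚ u) i
      ≈⟨ coeff-*ₚ (p +ₚ q) u i ⟩
    convolve (p +ₚ q) (coeff u) i
      ≈⟨ convolve-+ₚ p q (coeff u) i ⟩
    convolve p (coeff u) i + convolve q (coeff u) i
      ≈⟨ +-cong (coeff-*ₚ p u i) (coeff-*ₚ q u i) ⟨
    coeff (p *ₚ u) i + coeff (q *ₚ u) i
      ≈⟨ coeff-+ₚ (p *ₚ u) (q *ₚ u) i ⟨
    coeff (p *ₚ u +ₚ q *ₚ u) i ∎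

  *ₚ-distribˡ-+ₚ : ∀ u p q → (u *ₚ (p +ₚ q)) ≈ₚ (u *ₚ p +ₚ u *ₚ q)
  *ₚ-distribˡ-+ₚ u p q i = begin
    coeff (u *ₚ (p +ₚ q)) i     ≈⟨ *ₚ-comm u (p +ₚ q) i ⟩
    coeff ((p +ₚ q) *ₚ u) i     ≈⟨ *ₚ-distribʳ-+ₚ u p q i ⟩
    coeff (p *ₚ u +ₚ q *ₚ u) i  ≈⟨ +ₚ-cong (p *ₚ u) (u *ₚ p) (q *ₚ u) (u *ₚ q)
                                     (*ₚ-comm p u) (*ₚ-comm q u) i ⟩
    coeff (u *ₚ p +ₚ u *ₚ q) i  ∎

  constant-*ₚ : ∀ r p → (constant r *ₚ p) ≈ₚ map (r *_) p
  constant-*ₚ r p zero    = trans (coeff-+ₚ (map (r *_) p) (0# ∷ []) zero) (+-identityʳ _)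
  constant-*ₚ r p (suc i) = trans (coeff-+ₚ (map (r *_) p) (0# ∷ []) (suc i)) (+-identityʳ _)

  *ₚ-identityˡ : ∀ p → (constant 1# *ₚ p) ≈ₚ p
  *ₚ-identityˡ p i = begin
    coeff (constant 1# *ₚ p) i  ≈⟨ constant-*ₚ 1# p i ⟩
    coeff (map (1# *_) p) i     ≈⟨ coeff-scale 1# p i ⟩
    1# * coeff p i              ≈⟨ *-identityˡ _ ⟩
    coeff p i                   ∎

  X-*ₚ : ∀ p → (X *ₚ p) ≈ₚ (0# ∷ p)
  X-*ₚ p zero    = trans (coeff-*ₚ X p zero) (zeroˡ _)
  X-*ₚ p (suc i) = begin
    coeff (X *ₚ p) (suc i)                               ≈⟨ coeff-*ₚ X p (suc i) ⟩
    0# * coeff p (suc i) + convolve (1# ∷ []) (coeff p) i ≈⟨ +-congʳ (zeroˡ _) ⟩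
    0# + convolve (1# ∷ []) (coeff p) i                  ≈⟨ +-identityˡ _ ⟩
    convolve (1# ∷ []) (coeff p) i                       ≈⟨ coeff-*ₚ (1# ∷ []) p i ⟨
    coeff (constant 1# *ₚ p) i                           ≈⟨ *ₚ-identityˡ p i ⟩
    coeff p i                                            ∎

  polynomialRing : CommutativeRing c ℓ
  polynomialRing = record
    { RawRing polyRing
    ; isCommutativeRing = record
      { isRing = record
        { +-isAbelianGroup = record
          { isGroup = record
            { isMonoid = record
              { isSemigroup = record
                { isMagma = record
                  { isEquivalence = record
                    { refl  = λ i → refl
                    ; sym   = λ p≈q i → sym (p≈q i)
                    ; trans = λ p≈q q≈u i → trans (p≈q i) (q≈u i)
                    }
                  ; ∙-cong = λ {p} {q} {u} {v} → +ₚ-cong p q u v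
                  }
                ; assoc = +ₚ-assoc
                }
              ; identity = (λ p i → refl) , +ₚ-identityʳ
              }
            ; inverse = -ₚ-inverseˡ , λ p i →
                trans (+ₚ-comm p (map (-_) p) i) (-ₚ-inverseˡ p i)
            ; ⁻¹-cong = λ {p} {q} → -ₚ-cong p q
            }
          ; comm = +ₚ-comm
          }
        ; *-cong = λ {p} {q} {u} {v} → *ₚ-cong p q u v
        ; *-assoc = *ₚ-assoc
        ; *-identity = *ₚ-identityˡ , λ p i →
            trans (*ₚ-comm p (constant 1#) i) (*ₚ-identityˡ p i)
        ; distrib = *ₚ-distribˡ-+ₚ , *ₚ-distribʳ-+ₚ
        }
      ; *-comm = *ₚ-comm
      }
    }

  open RingMorphisms rawRing polyRing using (IsRingHomomorphism)

  constant-isRingHomomorphism : IsRingHomomorphism constant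
  constant-isRingHomomorphism = record
    { isSemiringHomomorphism = record
      { isNearSemiringHomomorphism = record
        { +-isMonoidHomomorphism = record
          { isMagmaHomomorphism = record
            { isRelHomomorphism = record
              { cong = λ { r≈s zero → r≈s ; r≈s (suc i) → refl } }
            ; homo = λ r s i → refl
            }
          ; ε-homo = λ { zero → refl ; (suc i) → refl }
          }
        ; *-homo = λ r s i → sym (constant-*ₚ r (constant s) i)
        }
      ; 1#-homo = λ i → refl
      }
    ; -‿homo = λ r i → refl
    }

  -- X (1 + d/dX)
  shiftedEuler : Poly → Poly
  shiftedEuler []      = []
  shiftedEuler (r ∷ p) = 0# ∷ (constant r +ₚ shiftedEuler p +ₚ p)

  private
    T = shiftedEuler
    # = fromℕ rawRing

    -- The action of X (1 + d/dX) on coefficient sequences. Congruence and linearity are visible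
    -- here, and `coeff-T` carries them to the recursion on lists.
    t : (ℕ → Carrier) → ℕ → Carrier
    t g zero    = 0#
    t g (suc i) = g i + # (suc i) * g (suc i)

    t-cong : ∀ {g h} → (∀ i → g i ≈ h i) → ∀ i → t g i ≈ t h i
    t-cong g≈h zero    = refl
    t-cong g≈h (suc i) = +-cong (g≈h i) (*-congˡ (g≈h (suc i)))

    coeff-T : ∀ p i → coeff (T p) i ≈ t (coeff p) i
    coeff-T []      zero    = refl
    coeff-T []      (suc i) =
      solve 1 (λ n → con 0 := con 0 :+ n :* con 0) refl _
    coeff-T (r ∷ p) zero    = refl
    coeff-T (r ∷ p) (suc i) = begin
      coeff (constant r +ₚ T p +ₚ p) i
        ≈⟨ coeff-+ₚ (constant r +ₚ T p) p i ⟩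
      coeff (constant r +ₚ T p) i + coeff p i
        ≈⟨ +-congʳ (coeff-+ₚ (constant r) (T p) i) ⟩
      coeff (constant r) i + coeff (T p) i + coeff p i
        ≈⟨ +-congʳ (+-congˡ (coeff-T p i)) ⟩
      coeff (constant r) i + t (coeff p) i + coeff p i
        ≈⟨ go i ⟩
      coeff (r ∷ p) i + # (suc i) * coeff p i ∎
      where
      go : ∀ i → coeff (constant r) i + t (coeff p) i + coeff p i ≈
                 coeff (r ∷ p) i + # (suc i) * coeff p i
      go zero    = solve 2 (λ r p →
        r :+ con 0 :+ p := r :+ (con 1 :+ con 0) :* p) refl _ _
      go (suc i) = solve 3 (λ u v n →
        con 0 :+ (u :+ n :* v) :+ v := u :+ (con 1 :+ n) :* v) refl _ _ _

  shiftedEuler-cong : ∀ p q → p ≈ₚ q → T p ≈ₚ T q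
  shiftedEuler-cong p q p≈q i =
    trans (coeff-T p i) (trans (t-cong p≈q i) (sym (coeff-T q i)))

  shiftedEuler-+ₚ : ∀ p q → T (p +ₚ q) ≈ₚ (T p +ₚ T q)
  shiftedEuler-+ₚ p q i = begin
    coeff (T (p +ₚ q)) i               ≈⟨ coeff-T (p +ₚ q) i ⟩
    t (coeff (p +ₚ q)) i               ≈⟨ t-cong (coeff-+ₚ p q) i ⟩
    t (λ j → coeff p j + coeff q j) i  ≈⟨ go i ⟩
    t (coeff p) i + t (coeff q) i      ≈⟨ +-cong (coeff-T p i) (coeff-T q i) ⟨
    coeff (T p) i + coeff (T q) i      ≈⟨ coeff-+ₚ (T p) (T q) i ⟨
    coeff (T p +ₚ T q) i               ∎
    where
    go : ∀ i → t (λ j → coeff p j + coeff q j) i ≈ t (coeff p) i + t (coeff q) i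
    go zero    = sym (+-identityʳ 0#)
    go (suc i) = solve 5 (λ a b n u v →
      a :+ b :+ n :* (u :+ v) := (a :+ n :* u) :+ (b :+ n :* v))
      refl _ _ _ _ _

  shiftedEuler-scale : ∀ r p → map (r *_) (T p) ≈ₚ T (map (r *_) p)
  shiftedEuler-scale r p i = begin
    coeff (map (r *_) (T p)) i     ≈⟨ coeff-scale r (T p) i ⟩
    r * coeff (T p) i              ≈⟨ *-congˡ (coeff-T p i) ⟩
    r * t (coeff p) i              ≈⟨ go i ⟩
    t (λ j → r * coeff p j) i      ≈⟨ t-cong (coeff-scale r p) i ⟨
    t (coeff (map (r *_) p)) i     ≈⟨ coeff-T (map (r *_) p) i ⟨
    coeff (T (map (r *_) p)) i     ∎
    where
    go : ∀ i → r * t (coeff p) i ≈ t (λ j → r * coeff p j) i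
    go zero    = zeroʳ r
    go (suc i) = solve 4 (λ r a n u →
      r :* (a :+ n :* u) := r :* a :+ n :* (r :* u)) refl _ _ _ _

  -- The recursion of `shiftedEuler` has this relation built in: on `0# ∷ p` it differs from the
  -- claim only by a summand `constant 0#`.
  shiftedEuler-X-*ₚ : ∀ p → T (X *ₚ p) ≈ₚ (X *ₚ (T p +ₚ p))
  shiftedEuler-X-*ₚ p i = begin
    coeff (T (X *ₚ p)) i       ≈⟨ shiftedEuler-cong (X *ₚ p) (0# ∷ p) (X-*ₚ p) i ⟩
    coeff (T (0# ∷ p)) i       ≈⟨ go i ⟩
    coeff (0# ∷ (T p +ₚ p)) i  ≈⟨ X-*ₚ (T p +ₚ p) i ⟨
    coeff (X *ₚ (T p +ₚ p)) i  ∎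
    where
    go : ∀ i → coeff (T (0# ∷ p)) i ≈ coeff (0# ∷ (T p +ₚ p)) i
    go zero    = refl
    go (suc i) = +ₚ-cong (constant 0# +ₚ T p) (T p) p p
      (λ j → trans (coeff-+ₚ (constant 0#) (T p) j)
        (trans (+-congʳ (IsRingHomomorphism.0#-homo constant-isRingHomomorphism j))
               (+-identityˡ _)))
      (λ j → refl) i

-- The linear map with r Xⁱ ↦ tⁱ (e r).
module Horner (R : CommutativeRing c ℓ) (G : AbelianGroup a ℓ₁)
  {e : CommutativeRing.Carrier R → AbelianGroup.Carrier G}
  {t : AbelianGroup.Carrier G → AbelianGroup.Carrier G}
  (e-isHom : MonoidMorphisms.IsMonoidHomomorphism
               (CommutativeRing.+-rawMonoid R) (AbelianGroup.rawMonoid G) e)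
  (t-isHom : MonoidMorphisms.IsMonoidHomomorphism
               (AbelianGroup.rawMonoid G) (AbelianGroup.rawMonoid G) t)
  where

  private
    module R = CommutativeRing R
    module e = MonoidMorphisms.IsMonoidHomomorphism e-isHom
    module t = MonoidMorphisms.IsMonoidHomomorphism t-isHom
  open AbelianGroup G
  open Polynomial R
  open SetoidReasoning setoid
  open CommutativeSemigroupProperties commutativeSemigroup using (interchange)

  horner : Poly → Carrier
  horner []      = ε
  horner (r ∷ p) = e r ∙ t (horner p)

  private
    horner-∷-zero : ∀ {r p} → r R.≈ R.0# → horner p ≈ ε → horner (r ∷ p) ≈ ε
    horner-∷-zero {r} {p} r≈0 hp≈ε = begin
      e r ∙ t (horner p)  ≈⟨ ∙-cong (trans (e.⟦⟧-cong r≈0) e.ε-homo) (trans (t.⟦⟧-cong hp≈ε) t.ε-homo) ⟩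
      ε ∙ ε               ≈⟨ identityˡ ε ⟩
      ε                   ∎

    -- Covers the case in which one of two equal lists ends before the other.
    horner-zero : ∀ p → p ≈ₚ [] → horner p ≈ ε
    horner-zero []      p≈0 = refl
    horner-zero (r ∷ p) p≈0 =
      horner-∷-zero {p = p} (p≈0 0) (horner-zero p (λ i → p≈0 (suc i)))

  horner-cong : ∀ p q → p ≈ₚ q → horner p ≈ horner q
  horner-cong []      q       p≈q = sym (horner-zero q (λ i → R.sym (p≈q i)))
  horner-cong (r ∷ p) []      p≈q = horner-zero (r ∷ p) p≈q
  horner-cong (r ∷ p) (s ∷ q) p≈q =
    ∙-cong (e.⟦⟧-cong (p≈q 0)) (t.⟦⟧-cong (horner-cong p q (λ i → p≈q (suc i))))

  horner-+ₚ : ∀ p q → horner (p +ₚ q) ≈ horner p ∙ horner q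
  horner-+ₚ []      q       = sym (identityˡ _)
  horner-+ₚ (r ∷ p) []      = sym (identityʳ _)
  horner-+ₚ (r ∷ p) (s ∷ q) = begin
    e (r R.+ s) ∙ t (horner (p +ₚ q))
      ≈⟨ ∙-cong (e.homo r s) (trans (t.⟦⟧-cong (horner-+ₚ p q)) (t.homo _ _)) ⟩
    e r ∙ e s ∙ (t (horner p) ∙ t (horner q))
      ≈⟨ interchange _ _ _ _ ⟩
    e r ∙ t (horner p) ∙ (e s ∙ t (horner q)) ∎

  horner-isMonoidHomomorphism : MonoidMorphisms.IsMonoidHomomorphism
    (RawRing.+-rawMonoid polyRing) rawMonoid horner
  horner-isMonoidHomomorphism = record
    { isMagmaHomomorphism = record
      { isRelHomomorphism = record { cong = λ {p} {q} → horner-cong p q }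
      ; homo = horner-+ₚ
      }
    ; ε-homo = refl
    }

  horner-constant : ∀ r → horner (constant r) ≈ e r
  horner-constant r = trans (∙-congˡ t.ε-homo) (identityʳ _)

  horner-0∷ : ∀ p → horner (R.0# ∷ p) ≈ t (horner p)
  horner-0∷ p = trans (∙-congʳ e.ε-homo) (identityˡ _)

  -- Naturality of Horner's rule, for scaling and for negation: an additive `β` that commutes with
  -- `t` passes through to the coefficients.
  horner-map : ∀ {α : R.Carrier → R.Carrier} {β : Carrier → Carrier} →
    (∀ g h → β (g ∙ h) ≈ β g ∙ β h) → β ε ≈ ε →
    (∀ r → β (e r) ≈ e (α r)) → (∀ g → β (t g) ≈ t (β g)) →
    ∀ p → horner (map α p) ≈ β (horner p)
  horner-map β-∙ β-ε β-e β-t []      = sym β-ε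
  horner-map {α} {β} β-∙ β-ε β-e β-t (r ∷ p) = sym (begin
    β (e r ∙ t (horner p))          ≈⟨ β-∙ _ _ ⟩
    β (e r) ∙ β (t (horner p))      ≈⟨ ∙-cong (β-e r) (β-t _) ⟩
    e (α r) ∙ t (β (horner p))      ≈⟨ ∙-congˡ (t.⟦⟧-cong (horner-map β-∙ β-ε β-e β-t p)) ⟨
    e (α r) ∙ t (horner (map α p))  ∎)

-- Evaluation of polynomials in an associative algebra

module Evaluation {R : CommutativeRing c ℓ} (A : AssociativeAlgebra R a ℓ₁)
                  (x : AssociativeAlgebra.Carrier A) where
  private module R = CommutativeRing R
  open AssociativeAlgebra A
  open RingMorphisms.IsRingHomomorphism isRingHomomorphism
  open Polynomial R
  open PolynomialRing R
  open RingProperties ring using (-0#≈0#; -‿distribʳ-*)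
  open AbelianGroupProperties +-abelianGroup using (⁻¹-∙-comm)
  open SetoidReasoning setoid

  private
    x*-isMonoidHomomorphism : MonoidMorphisms.IsMonoidHomomorphism
      (RawRing.+-rawMonoid rawRing) (RawRing.+-rawMonoid rawRing) (x *_)
    x*-isMonoidHomomorphism = record
      { isMagmaHomomorphism = record
        { isRelHomomorphism = record { cong = *-congˡ }
        ; homo = distribˡ x
        }
      ; ε-homo = zeroʳ x
      }

  open Horner R +-abelianGroup +-isMonoidHomomorphism x*-isMonoidHomomorphism

  evaluate : Poly → Carrier
  evaluate = horner

  -- Centrality of the scalars enters here: `ι r` has to move past `x`.
  evaluate-scale : ∀ r p → evaluate (map (r R.*_) p) ≈ ι r * evaluate p
  evaluate-scale r = horner-map (distribˡ (ι r)) (zeroʳ (ι r))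
    (λ s → sym (*-homo r s)) λ g → begin
      ι r * (x * g)  ≈⟨ *-assoc _ _ _ ⟨
      ι r * x * g    ≈⟨ *-congʳ (central r x) ⟩
      x * ι r * g    ≈⟨ *-assoc _ _ _ ⟩
      x * (ι r * g)  ∎

  -- Powers of `x` are always split off on the left, so the only reordering is that of scalars past
  -- `x`, and the algebra may be noncommutative.
  evaluate-*ₚ : ∀ p q → evaluate (p *ₚ q) ≈ evaluate p * evaluate q
  evaluate-*ₚ []      q = sym (zeroˡ _)
  evaluate-*ₚ (r ∷ p) q = begin
    evaluate (map (r R.*_) q +ₚ (R.0# ∷ (p *ₚ q)))
      ≈⟨ horner-+ₚ (map (r R.*_) q) (R.0# ∷ (p *ₚ q)) ⟩
    evaluate (map (r R.*_) q) + evaluate (R.0# ∷ (p *ₚ q))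
      ≈⟨ +-cong (evaluate-scale r q) (horner-0∷ (p *ₚ q)) ⟩
    ι r * evaluate q + x * evaluate (p *ₚ q)
      ≈⟨ +-congˡ (trans (*-congˡ (evaluate-*ₚ p q)) (sym (*-assoc _ _ _))) ⟩
    ι r * evaluate q + x * evaluate p * evaluate q
      ≈⟨ distribʳ _ _ _ ⟨
    evaluate (r ∷ p) * evaluate q ∎

  evaluate-X : evaluate X ≈ x
  evaluate-X = begin
    evaluate X                    ≈⟨ horner-0∷ (R.1# ∷ []) ⟩
    x * evaluate (constant R.1#)  ≈⟨ *-congˡ (horner-constant R.1#) ⟩
    x * ι R.1#                    ≈⟨ *-congˡ 1#-homo ⟩
    x * 1#                        ≈⟨ *-identityʳ x ⟩
    x                             ∎

  evaluate-constant : ∀ r → evaluate (constant r) ≈ ι r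
  evaluate-constant = horner-constant

  evaluate-isRingHomomorphism :
    RingMorphisms.IsRingHomomorphism polyRing rawRing evaluate
  evaluate-isRingHomomorphism = record
    { isSemiringHomomorphism = record
      { isNearSemiringHomomorphism = record
        { +-isMonoidHomomorphism = horner-isMonoidHomomorphism
        ; *-homo = evaluate-*ₚ
        }
      ; 1#-homo = trans (horner-constant R.1#) 1#-homo
      }
    ; -‿homo = horner-map (λ g h → sym (⁻¹-∙-comm g h)) -0#≈0#
        (λ r → sym (-‿homo r)) (-‿distribʳ-* x)
    }

-- The map Φ on R[X] and the identity there

module PolynomialSpivey (R : CommutativeRing c ℓ) where
  open CommutativeRing R hiding (zero)
  open Polynomial R
  open PolynomialRing R
  private module P = CommutativeRing polynomialRing
  open RingMorphisms.IsRingHomomorphism constant-isRingHomomorphism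

  private
    shiftedEuler-isMonoidHomomorphism : MonoidMorphisms.IsMonoidHomomorphism
      P.+-rawMonoid P.+-rawMonoid shiftedEuler
    shiftedEuler-isMonoidHomomorphism = record
      { isMagmaHomomorphism = record
        { isRelHomomorphism = record { cong = λ {p} {q} → shiftedEuler-cong p q }
        ; homo = shiftedEuler-+ₚ
        }
      ; ε-homo = λ i → refl
      }

  open Horner R P.+-abelianGroup
    +-isMonoidHomomorphism shiftedEuler-isMonoidHomomorphism

  -- This is Φ, as p(T) 1; its value at Xⁱ is the classical Bell (Touchard) polynomial.
  umbral : Poly → Poly
  umbral = horner

  umbral-constant-*ₚ : ∀ r p → umbral (constant r *ₚ p) ≈ₚ (constant r *ₚ umbral p)
  umbral-constant-*ₚ r p i = begin
    coeff (umbral (constant r *ₚ p)) i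
      ≈⟨ horner-cong (constant r *ₚ p) (map (r *_) p) (constant-*ₚ r p) i ⟩
    coeff (umbral (map (r *_) p)) i
      ≈⟨ horner-map {β = map (r *_)} scale-+ₚ (λ i → refl) (λ s i → refl)
           (shiftedEuler-scale r) p i ⟩
    coeff (map (r *_) (umbral p)) i
      ≈⟨ constant-*ₚ r (umbral p) i ⟨
    coeff (constant r *ₚ umbral p) i ∎
    where
    open SetoidReasoning setoid
    scale-+ₚ : ∀ p q → map (r *_) (p +ₚ q) ≈ₚ (map (r *_) p +ₚ map (r *_) q)
    scale-+ₚ p q i = begin
      coeff (map (r *_) (p +ₚ q)) i  ≈⟨ coeff-scale r (p +ₚ q) i ⟩
      r * coeff (p +ₚ q) i           ≈⟨ *-congˡ (coeff-+ₚ p q i) ⟩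
      r * (coeff p i + coeff q i)    ≈⟨ distribˡ _ _ _ ⟩
      r * coeff p i + r * coeff q i  ≈⟨ +-cong (coeff-scale r p i) (coeff-scale r q i) ⟨
      coeff (map (r *_) p) i + coeff (map (r *_) q) i
        ≈⟨ coeff-+ₚ (map (r *_) p) (map (r *_) q) i ⟨
      coeff (map (r *_) p +ₚ map (r *_) q) i ∎

  umbral-X-*ₚ : ∀ p → umbral (X *ₚ p) ≈ₚ shiftedEuler (umbral p)
  umbral-X-*ₚ p i =
    trans (horner-cong (X *ₚ p) (0# ∷ p) (X-*ₚ p) i) (horner-0∷ p i)

  spivey : ∀ μ S → IsDegenerateStirling₂ R μ S → ∀ m n →
    Spivey R S polyRing constant μ m n X
  spivey μ S isStirling = Umbral.spivey R polynomialRing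
    constant-isRingHomomorphism X shiftedEuler horner-isMonoidHomomorphism
    umbral-constant-*ₚ (horner-constant 1#) umbral-X-*ₚ
    (λ {p} {q} → shiftedEuler-cong p q) (λ i → refl) shiftedEuler-X-*ₚ
    μ S (IsDegenerateStirling₂⇒∑ R isStirling)

theorem2p5 : ∀ {c ℓ a ℓ₁} (R : CommutativeRing c ℓ) →
    let module R = CommutativeRing R
        open Polynomial R in
    (μ : R.Carrier) → ¬ (μ R.≈ R.0#) →
    (S : ℕ → ℕ → R.Carrier) → IsDegenerateStirling₂ R μ S →
    (m n : ℕ) →
    SpiveyIdentity R S polyRing constant μ m n X
    × ((A : AssociativeAlgebra R a ℓ₁) →
       let open AssociativeAlgebra A in
       (a⁻ a⁺ : Carrier) → a⁻ * a⁺ - a⁺ * a⁻ ≈ 1# →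
       SpiveyIdentity R S rawRing ι μ m n a⁺)
theorem2p5 R μ _ S isStirling m n =
  Spivey⇒SpiveyIdentity R S polyRing constant m n inR[X] ,
  λ A a⁻ a⁺ _ →
    let open AssociativeAlgebra A using (ring; rawRing; ι)
        open Evaluation A a⁺
    in Spivey⇒SpiveyIdentity R S rawRing ι m n
         (Homomorphism.Spivey-homo polyRing ring evaluate-isRingHomomorphism R
           {ι = constant} evaluate-constant S {x = X} evaluate-X μ m n inR[X])
  where
  open Polynomial R
  inR[X] : Spivey R S polyRing constant μ m n X
  inR[X] = PolynomialSpivey.spivey R μ S isStirling m n
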